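{- Let $\alpha,\beta\in\mathbb{Z}_{\geq0}^n$. If $\beta\preceq\alpha$, then $\beta$ is a vertex of $\mathsf{Newton}(\kappa_\alpha)\subseteq\mathbb{R}^n$.
   Context: For $f\in\mathbb{Z}[x_1,x_2,\ldots]$ let $\partial_i f=\frac{f-s_if}{x_i-x_{i+1}}$, where $s_i$ swaps $x_i$ and $x_{i+1}$, and let $\pi_i(f)=\partial_i(x_if)$. For a composition $\alpha=(\alpha_1,\alpha_2,\ldots)$ of nonnegative integers with finite sum, the key polynomial $\kappa_\alpha$ is $x^\alpha=x_1^{\alpha_1}x_2^{\alpha_2}\cdots$ if $\alpha$ is weakly decreasing, and otherwise $\kappa_\alpha=\pi_i(\kappa_{\widehat\alpha})$, where $i$ is such that $\alpha_{i+1}>\alpha_i$ and $\widehat\alpha$ is $\alpha$ with entries $i,i+1$ swapped (this is well defined). For $\gamma\in\mathbb{Z}^n_{\geq0}$, $\lambda(\gamma)$ is its decreasing rearrangement and $w(\gamma)\in S_n$ is the shortest-length permutation sending $\lambda(\gamma)$ to $\gamma$ by permuting coordinates. Write $\gamma\preceq\alpha$ if $\lambda(\gamma)=\lambda(\alpha)$ and $w(\gamma)\leq w(\alpha)$ in (strong) Bruhat order on $S_n$. $\mathsf{Newton}(f)$ is the convex hull of the exponent vectors of $f$.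
   Formalization: The Newton polytope is taken in rational rather than real n-space: it is the set of rational convex combinations of the exponent vectors, and "vertex" means that β is not strictly between two distinct rational points of this set. -}

module Defs where

open import Data.Nat as ℕ using (ℕ; zero; suc; _∸_; _≤ᵇ_; _<ᵇ_)
open import Data.Integer as ℤ using (ℤ)
open import Data.Rational as ℚ using (ℚ; 0ℚ; 1ℚ)
open import Data.Bool using (Bool; true; false; if_then_else_)
open import Data.Fin using (Fin; _<_)
open import Data.Fin.Permutation using (Permutation′; _⟨$⟩ʳ_; transpose)
open import Data.Vec as Vec using (Vec; []; _∷_; lookup)
open import Data.Vec.Properties using (≡-dec)
open import Data.List as List using (List; []; _∷_; concatMap; allFin; upTo)
open import Data.List.Relation.Unary.All using (All)
open import Data.Maybe using (Maybe; just; nothing)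
import Data.Maybe
open import Data.Nat.ListAction using () renaming (sum to sumℕ)
import Data.Fin
open import Data.Product using (_×_; _,_; Σ; ∃; ∃-syntax; proj₁; proj₂)
open import Relation.Nullary using (¬_; yes; no)
open import Relation.Binary.PropositionalEquality using (_≡_; _≢_)
open import Relation.Binary.Construct.Closure.ReflexiveTransitive using (Star)

-- Polynomials in ℤ[x₁,…,xₙ] as formal (unnormalised) sums of terms
-- c · x^e, e ∈ ℕⁿ.  Positions are 0-based: position i ↔ variable x_{i+1}.

Poly : ℕ → Set
Poly n = List (ℤ × Vec ℕ n)

coeff : ∀ {n} → Poly n → Vec ℕ n → ℤ
coeff []            e = ℤ.0ℤ
coeff ((c , e′) ∷ f) e with ≡-dec ℕ._≟_ e′ e
... | yes _ = c ℤ.+ coeff f e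
... | no  _ = coeff f e

get : ∀ {n} → ℕ → Vec ℕ n → ℕ
get i       []       = 0
get zero    (a ∷ as) = a
get (suc i) (a ∷ as) = get i as

set2 : ∀ {n} → ℕ → ℕ → ℕ → Vec ℕ n → Vec ℕ n
set2 i       p q []            = []
set2 zero    p q (a ∷ [])      = p ∷ []
set2 zero    p q (a ∷ b ∷ as)  = p ∷ q ∷ as
set2 (suc i) p q (a ∷ as)      = a ∷ set2 i p q as

swapAdj : ∀ {n} → ℕ → Vec ℕ n → Vec ℕ n
swapAdj i e = set2 i (get (suc i) e) (get i e) e

bump : ∀ {n} → ℕ → Vec ℕ n → Vec ℕ n
bump i       []       = []
bump zero    (a ∷ as) = suc a ∷ as
bump (suc i) (a ∷ as) = a ∷ bump i as

-- divided difference on a monomial x^e, with p = e_i, q = e_{i+1}: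
--   (x^e - s_i x^e)/(x_i - x_{i+1})
--   = Σ_{k<p-q} x_i^{p-1-k} x_{i+1}^{q+k} · (rest)        if q ≤ p
--   = - Σ_{k<q-p} x_i^{q-1-k} x_{i+1}^{p+k} · (rest)      if p < q
∂mono : ∀ {n} → ℕ → ℤ × Vec ℕ n → Poly n
∂mono i (c , e) with get i e | get (suc i) e
... | p | q with q ≤ᵇ p
...   | true  = List.map (λ k → c , set2 i (p ∸ 1 ∸ k) (q ℕ.+ k) e) (upTo (p ∸ q))
...   | false = List.map (λ k → ℤ.- c , set2 i (q ∸ 1 ∸ k) (p ℕ.+ k) e) (upTo (q ∸ p))

-- ∂_i (0-based position i, i.e. the operator ∂_{i+1} of the paper)
∂ : ∀ {n} → ℕ → Poly n → Poly n
∂ i f = concatMap (∂mono i) f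

mulx : ∀ {n} → ℕ → Poly n → Poly n
mulx i f = List.map (λ t → proj₁ t , bump i (proj₂ t)) f

π : ∀ {n} → ℕ → Poly n → Poly n
π i f = ∂ i (mulx i f)

firstAscent : ∀ {n} → Vec ℕ n → Maybe ℕ
firstAscent []           = nothing
firstAscent (a ∷ [])     = nothing
firstAscent (a ∷ b ∷ as) =
  if a <ᵇ b then just zero else Data.Maybe.map suc (firstAscent (b ∷ as))

-- key polynomial with fuel: x^α if α weakly decreasing, otherwise
-- π_i κ_{s_i α} for the first ascent i.  Each step removes exactly one
-- inversion, so fuel n*n is always sufficient.
keyF : ∀ {n} → ℕ → Vec ℕ n → Poly n
keyF fuel α with firstAscent α
keyF fuel       α | nothing = (ℤ.1ℤ , α) ∷ []
keyF zero       α | just i  = []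
keyF (suc fuel) α | just i  = π i (keyF fuel (swapAdj i α))

key : ∀ {n} → Vec ℕ n → Poly n
key {n} α = keyF (n ℕ.* n) α

Pt : ℕ → Set
Pt n = Vec ℚ n

toPt : ∀ {n} → Vec ℕ n → Pt n
toPt = Vec.map (λ k → ℤ.+ k ℚ./ 1)

_⊕_ : ∀ {n} → Pt n → Pt n → Pt n
_⊕_ = Vec.zipWith ℚ._+_

_⊛_ : ∀ {n} → ℚ → Pt n → Pt n
c ⊛ p = Vec.map (c ℚ.*_) p

zeroPt : ∀ {n} → Pt n
zeroPt = Vec.replicate _ 0ℚ

InSupp : ∀ {n} → Poly n → Vec ℕ n → Set
InSupp f e = coeff f e ≢ ℤ.0ℤ

wsum : ∀ {n} → List (ℚ × Vec ℕ n) → ℚ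
wsum []             = 0ℚ
wsum ((c , e) ∷ ws) = c ℚ.+ wsum ws

wcomb : ∀ {n} → List (ℚ × Vec ℕ n) → Pt n
wcomb []             = zeroPt
wcomb ((c , e) ∷ ws) = (c ⊛ toPt e) ⊕ wcomb ws

InNewton : ∀ {n} → Poly n → Pt n → Set
InNewton f p = ∃[ ws ] (All (λ w → (0ℚ ℚ.≤ proj₁ w) × InSupp f (proj₂ w)) ws
                       × wsum ws ≡ 1ℚ × wcomb ws ≡ p)

IsVertex : ∀ {n} → Poly n → Pt n → Set
IsVertex f v = InNewton f v
  × (∀ p q t → InNewton f p → InNewton f q → 0ℚ ℚ.< t → t ℚ.< 1ℚ
       → v ≡ (t ⊛ p) ⊕ ((1ℚ ℚ.- t) ⊛ q) → p ≡ q)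

insertDec : ∀ {n} → ℕ → Vec ℕ n → Vec ℕ (suc n)
insertDec x []       = x ∷ []
insertDec x (y ∷ ys) = if y ≤ᵇ x then x ∷ y ∷ ys else y ∷ insertDec x ys

sortDec : ∀ {n} → Vec ℕ n → Vec ℕ n
sortDec []       = []
sortDec (x ∷ xs) = insertDec x (sortDec xs)

Perm : ℕ → Set
Perm = Permutation′

invCount : ∀ {n} → Perm n → ℕ
invCount {n} w = sumℕ (List.map (λ i → sumℕ (List.map (λ j → cnt i j) (allFin n))) (allFin n))
  where
  cnt : Fin n → Fin n → ℕ
  cnt i j with Data.Fin._<?_ i j | Data.Fin._<?_ (w ⟨$⟩ʳ j) (w ⟨$⟩ʳ i)
  ... | yes _ | yes _ = 1
  ... | _     | _     = 0

len : ∀ {n} → Perm n → ℕ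
len = invCount

BruhatStep : ∀ {n} → Perm n → Perm n → Set
BruhatStep u w = ∃[ i ] ∃[ j ] (i ≢ j)
  × (∀ k → w ⟨$⟩ʳ k ≡ u ⟨$⟩ʳ (transpose i j ⟨$⟩ʳ k))
  × len u ℕ.< len w

_≤B_ : ∀ {n} → Perm n → Perm n → Set
_≤B_ = Star BruhatStep

Sends : ∀ {n} → Vec ℕ n → Vec ℕ n → Perm n → Set
Sends lam γ w = ∀ i → lookup γ (w ⟨$⟩ʳ i) ≡ lookup lam i

IsW : ∀ {n} → Vec ℕ n → Perm n → Set
IsW γ w = Sends (sortDec γ) γ w × (∀ v → Sends (sortDec γ) γ v → len w ℕ.≤ len v)

_⪯_ : ∀ {n} → Vec ℕ n → Vec ℕ n → Set
β ⪯ α = sortDec β ≡ sortDec α × (∀ u w → IsW β u → IsW α w → u ≤B w)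

{-# OPTIONS --safe #-}

-- Let N be the sum of the squares of the entries of α, so |e|² ≤ N for every
-- exponent e of κ_α: applying π_i to x^e only produces exponents that agree
-- with e outside i, i+1 and whose entries there lie on the segment from
-- (e_i , e_{i+1}) to (e_{i+1} , e_i).  Hence Newton(κ_α) lies in the ball of
-- squared radius N.  A rearrangement β of α lies on the sphere, so by strict
-- convexity it is a vertex as soon as x^β occurs in κ_α.
--
-- Only the ends of these segments have the norm of e, so for |b|² maximal the
-- coefficient of x^b in π_i f is that of x^h in f, where h is the one of b, s_i b
-- with h_i ≥ h_{i+1}.  If α_i < α_{i+1} and β ⪯ α, then h ⪯ s_i α for the h
-- obtained from β; so the coefficient of x^β in κ_α is that of x^λ in x^λ.
--
-- For this step ⪯ is replaced by what it implies about prefixes: for all t and k,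
-- β has at least as many entries ≥ t among its first k entries as α.

module Submission where

open import Defs
open import Data.Nat using (ℕ)
open import Data.Vec using (Vec)
open import Data.Nat as ℕ using (zero; suc; _+_; _*_; _∸_; _≤_; _<_; z≤n; s≤s; _≤?_; _<?_; _≤ᵇ_; _<ᵇ_)
open import Data.Nat.Properties as ℕ
open import Data.Nat.Coprimality using (1-coprimeTo) renaming (sym to coprime-sym)
open import Data.Nat.Induction using (<-rec)
open import Data.Nat.ListAction using () renaming (sum to sumℕ)
open import Data.Nat.Solver using (module +-*-Solver)
open import Data.Integer as ℤ using (ℤ)
import Data.Integer.Properties as ℤ
open import Data.Rational as ℚ using (ℚ; 0ℚ; 1ℚ)
import Data.Rational.Properties as ℚ
import Data.Rational.Solver as ℚ
open import Data.Bool using (true; false; if_then_else_; T)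
open import Data.Unit using (tt)
open import Data.Fin as Fin using (Fin; zero; suc; toℕ)
import Data.Fin.Properties as Fin
open import Data.Fin.Permutation using (_⟨$⟩ʳ_; _⟨$⟩ˡ_; transpose; lift₀; _∘ₚ_; inverseˡ)
  renaming (id to idₚ)
open import Data.Vec using ([]; _∷_; lookup)
open import Data.Vec.Properties using (≡-dec)
open import Data.Vec.Relation.Unary.Linked using (Linked; []; [-]; _∷_)
open import Data.Vec.Relation.Unary.Linked.Properties using (lookup⁺)
open import Data.List as List using ([]; _∷_; _++_; applyUpTo; allFin; tabulate)
open import Data.List.Properties using (map-applyUpTo; map-tabulate)
open import Data.List.Relation.Unary.All as All using (All; []; _∷_)
import Data.List.Relation.Unary.All.Properties as All
open import Data.Maybe using (Maybe; just; nothing)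
open import Data.Product using (_×_; _,_; proj₁; proj₂; Σ; ∃-syntax)
open import Data.Sum using (_⊎_; inj₁; inj₂)
open import Algebra.Properties.CommutativeMonoid.Sum ℕ.+-0-commutativeMonoid
  using (sum; sum-permute; ∑-distrib-+; sum-cong-≗)
open import Function using (_∘_; id)
open import Relation.Nullary using (¬_; Dec; yes; no; contradiction)
open import Relation.Nullary.Decidable using (decidable-stable)
open import Relation.Binary using (tri<; tri≈; tri>)
open import Relation.Binary.Construct.Closure.ReflexiveTransitive using (ε; _◅_)
open import Relation.Binary.PropositionalEquality

private variable
  n i : ℕ

-- Indicators, prefix counts and squared norms

𝟙 : {P : Set} → Dec P → ℕ
𝟙 (yes _) = 1
𝟙 (no _)  = 0

𝟙-mono : {P Q : Set} (P? : Dec P) (Q? : Dec Q) → (P → Q) → 𝟙 P? ≤ 𝟙 Q?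
𝟙-mono (no _)  _       f = z≤n
𝟙-mono (yes _) (yes _) f = ≤-refl
𝟙-mono (yes p) (no ¬q) f = contradiction (f p) ¬q

𝟙-≤1 : {P : Set} (P? : Dec P) → 𝟙 P? ≤ 1
𝟙-≤1 (yes _) = ≤-refl
𝟙-≤1 (no _)  = z≤n

atLeast : ℕ → ℕ → Vec ℕ n → ℕ
atLeast t zero    v       = 0
atLeast t (suc k) []      = 0
atLeast t (suc k) (a ∷ v) = 𝟙 (t ≤? a) + atLeast t k v

atLeast-suc : ∀ t k (v : Vec ℕ n) → k < n → atLeast t (suc k) v ≡ atLeast t k v + 𝟙 (t ≤? get k v)
atLeast-suc t zero    (a ∷ v) _         = +-identityʳ _
atLeast-suc t (suc k) (a ∷ v) (s≤s k<n) =
  trans (cong (𝟙 (t ≤? a) +_) (atLeast-suc t k v k<n)) (sym (+-assoc (𝟙 (t ≤? a)) _ _))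

atLeast-≤ : ∀ t k (v : Vec ℕ n) → atLeast t k v ≤ n
atLeast-≤ t zero    v       = z≤n
atLeast-≤ t (suc k) []      = z≤n
atLeast-≤ t (suc k) (a ∷ v) = +-mono-≤ (𝟙-≤1 (t ≤? a)) (atLeast-≤ t k v)

+-swap : ∀ a b c → a + (b + c) ≡ b + (a + c)
+-swap a b c = trans (sym (+-assoc a b c)) (trans (cong (_+ c) (+-comm a b)) (+-assoc b a c))

norm² : Vec ℕ n → ℕ
norm² []      = 0
norm² (a ∷ v) = a * a + norm² v

-- Adjacent transpositions

get-swapˡ : (v : Vec ℕ n) → suc i < n → get i (swapAdj i v) ≡ get (suc i) v
get-swapˡ {i = zero}  (a ∷ b ∷ v) _       = refl
get-swapˡ {i = zero}  (a ∷ [])    (s≤s ())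
get-swapˡ {i = suc i} (a ∷ v)     (s≤s l) = get-swapˡ v l

get-swapʳ : (v : Vec ℕ n) → suc i < n → get (suc i) (swapAdj i v) ≡ get i v
get-swapʳ {i = zero}  (a ∷ b ∷ v) _       = refl
get-swapʳ {i = zero}  (a ∷ [])    (s≤s ())
get-swapʳ {i = suc i} (a ∷ v)     (s≤s l) = get-swapʳ v l

swapAdj-involutive : (v : Vec ℕ n) → suc i < n → swapAdj i (swapAdj i v) ≡ v
swapAdj-involutive {i = zero}  (a ∷ b ∷ v) _       = refl
swapAdj-involutive {i = zero}  (a ∷ [])    (s≤s ())
swapAdj-involutive {i = suc i} (a ∷ v)     (s≤s l) = cong (a ∷_) (swapAdj-involutive v l)

norm²-swap : (v : Vec ℕ n) → suc i < n → norm² (swapAdj i v) ≡ norm² v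
norm²-swap {i = zero}  (a ∷ b ∷ v) _       = +-swap (b * b) (a * a) (norm² v)
norm²-swap {i = zero}  (a ∷ [])    (s≤s ())
norm²-swap {i = suc i} (a ∷ v)     (s≤s l) = cong (a * a +_) (norm²-swap v l)

-- Only the prefix of length `suc i` ends between the two swapped positions; every other prefix
-- contains both of them or neither.
atLeast-swap : ∀ t k (v : Vec ℕ n) → suc i < n → k ≢ suc i → atLeast t k (swapAdj i v) ≡ atLeast t k v
atLeast-swap             t zero          v           _       _ = refl
atLeast-swap {i = zero}  t (suc zero)    v           _       k≢ = contradiction refl k≢
atLeast-swap {i = zero}  t (suc (suc k)) (a ∷ b ∷ v) _       _ = +-swap (𝟙 (t ≤? b)) (𝟙 (t ≤? a)) _
atLeast-swap {i = zero}  t (suc (suc k)) (a ∷ [])    (s≤s ())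
atLeast-swap {i = suc i} t (suc k)       (a ∷ v)     (s≤s l) k≢ =
  cong (𝟙 (t ≤? a) +_) (atLeast-swap t k v l (k≢ ∘ cong suc))

atLeast-swap-at : ∀ t (v : Vec ℕ n) → suc i < n →
                  atLeast t (suc i) (swapAdj i v) ≡ atLeast t i v + 𝟙 (t ≤? get (suc i) v)
atLeast-swap-at {i = i} t v l = begin
  atLeast t (suc i) (swapAdj i v)                              ≡⟨ atLeast-suc t i _ (<-trans (n<1+n i) l) ⟩
  atLeast t i (swapAdj i v) + 𝟙 (t ≤? get i (swapAdj i v))     ≡⟨ cong₂ (λ x y → x + 𝟙 (t ≤? y)) (atLeast-swap t i v l (1+n≢n ∘ sym)) (get-swapˡ v l) ⟩
  atLeast t i v + 𝟙 (t ≤? get (suc i) v)                       ∎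
  where open ≡-Reasoning

-- Entries and norms after `set2` and `bump`

get-set2ʳ : ∀ x y (v : Vec ℕ n) → suc i < n → get (suc i) (set2 i x y v) ≡ y
get-set2ʳ {i = zero}  x y (a ∷ b ∷ v) _       = refl
get-set2ʳ {i = zero}  x y (a ∷ [])    (s≤s ())
get-set2ʳ {i = suc i} x y (a ∷ v)     (s≤s l) = get-set2ʳ x y v l

get-bumpˡ : (v : Vec ℕ n) → suc i < n → get i (bump i v) ≡ suc (get i v)
get-bumpˡ {i = zero}  (a ∷ v) _       = refl
get-bumpˡ {i = suc i} (a ∷ v) (s≤s l) = get-bumpˡ v l

get-bumpʳ : ∀ i (v : Vec ℕ n) → get (suc i) (bump i v) ≡ get (suc i) v
get-bumpʳ i       []      = refl
get-bumpʳ zero    (a ∷ v) = refl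
get-bumpʳ (suc i) (a ∷ v) = get-bumpʳ i v

set2-bump : ∀ i x y (v : Vec ℕ n) → set2 i x y (bump i v) ≡ set2 i x y v
set2-bump i       x y []          = refl
set2-bump zero    x y (a ∷ [])    = refl
set2-bump zero    x y (a ∷ b ∷ v) = refl
set2-bump (suc i) x y (a ∷ v)     = cong (a ∷_) (set2-bump i x y v)

set2-get : (v : Vec ℕ n) → suc i < n → set2 i (get i v) (get (suc i) v) v ≡ v
set2-get {i = zero}  (a ∷ b ∷ v) _       = refl
set2-get {i = zero}  (a ∷ [])    (s≤s ())
set2-get {i = suc i} (a ∷ v)     (s≤s l) = cong (a ∷_) (set2-get v l)

norm²-set2 : ∀ x y (v : Vec ℕ n) → suc i < n →
            norm² (set2 i x y v) + (get i v * get i v + get (suc i) v * get (suc i) v) ≡ norm² v + (x * x + y * y)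
norm²-set2 {i = zero}  x y (a ∷ b ∷ v) _       =
  solve 5 (λ x y a b m → (x :+ (y :+ m)) :+ (a :+ b) := (a :+ (b :+ m)) :+ (x :+ y)) refl (x * x) (y * y) (a * a) (b * b) (norm² v)
  where open +-*-Solver
norm²-set2 {i = zero}  x y (a ∷ [])    (s≤s ())
norm²-set2 {i = suc i} x y (a ∷ v)     (s≤s l) = begin
  a * a + norm² (set2 i x y v) + _   ≡⟨ +-assoc (a * a) _ _ ⟩
  a * a + (norm² (set2 i x y v) + _) ≡⟨ cong (a * a +_) (norm²-set2 x y v l) ⟩
  a * a + (norm² v + _)              ≡⟨ +-assoc (a * a) _ _ ⟨
  a * a + norm² v + _                ∎
  where open ≡-Reasoning

-- Rests on (a+u)² + (a+v)² + 2uv = (a+u+v)² + a². The loss of norm along a string is thus 2uv,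
-- which vanishes only at the two ends, where u = 0 or v = 0.
norm²-string : ∀ a u v (e : Vec ℕ n) → suc i < n →
              get i e * get i e + get (suc i) e * get (suc i) e ≡ (a + u + v) * (a + u + v) + a * a →
              norm² (set2 i (a + u) (a + v) e) + 2 * (u * v) ≡ norm² e
norm²-string {i = i} a u v e l eq = +-cancelʳ-≡ S _ _ (begin
  N + 2 * (u * v) + S                                        ≡⟨ solve 3 (λ N w S → N :+ w :+ S := (N :+ S) :+ w) refl N (2 * (u * v)) S ⟩
  N + S + 2 * (u * v)                                        ≡⟨ cong (_+ 2 * (u * v)) (trans (cong (N +_) (sym eq)) (norm²-set2 (a + u) (a + v) e l)) ⟩
  norm² e + ((a + u) * (a + u) + (a + v) * (a + v)) + 2 * (u * v)
    ≡⟨ solve 4 (λ m a u v → m :+ ((a :+ u) :* (a :+ u) :+ (a :+ v) :* (a :+ v)) :+ con 2 :* (u :* v)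
                          := m :+ ((a :+ u :+ v) :* (a :+ u :+ v) :+ a :* a)) refl (norm² e) a u v ⟩
  norm² e + S                                                 ∎)
  where
  open ≡-Reasoning
  open +-*-Solver
  N = norm² (set2 i (a + u) (a + v) e)
  S = (a + u + v) * (a + u + v) + a * a

-- Exponents and coefficients under π

coeff-++ : (f g : Poly n) (e : Vec ℕ n) → coeff (f ++ g) e ≡ coeff f e ℤ.+ coeff g e
coeff-++ []             g e = sym (ℤ.+-identityˡ _)
coeff-++ ((c , e′) ∷ f) g e with ≡-dec ℕ._≟_ e′ e
... | yes _ = trans (cong (ℤ._+_ c) (coeff-++ f g e)) (sym (ℤ.+-assoc c _ _))
... | no  _ = coeff-++ f g e

coeff-absent : (f : Poly n) (e : Vec ℕ n) → All (λ t → proj₂ t ≢ e) f → coeff f e ≡ ℤ.0ℤ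
coeff-absent []             e []       = refl
coeff-absent ((c , e′) ∷ f) e (p ∷ ps) with ≡-dec ℕ._≟_ e′ e
... | yes q = contradiction q p
... | no  _ = coeff-absent f e ps

-- Polynomials are unnormalised, so injectivity of `g` is what prevents a second term at `e` from
-- adding to `c`.
coeff-applyUpTo : ∀ c (g : ℕ → Vec ℕ n) (e : Vec ℕ n) m k → k < m → g k ≡ e →
                  (∀ {j j′} → g j ≡ g j′ → j ≡ j′) →
                  coeff (applyUpTo (λ j → c , g j) m) e ≡ c
coeff-applyUpTo c g e (suc m) zero    _       eq inj with ≡-dec ℕ._≟_ (g 0) e
... | no ¬q = contradiction eq ¬q
... | yes q = trans (cong (ℤ._+_ c) (coeff-absent _ e (All.applyUpTo⁺₂ _ m λ j gj≡e → 1+n≢0 (inj (trans gj≡e (sym eq))))))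
                    (ℤ.+-identityʳ c)
coeff-applyUpTo c g e (suc m) (suc k) (s≤s l) eq inj with ≡-dec ℕ._≟_ (g 0) e
... | yes q = contradiction (inj (trans eq (sym q))) 1+n≢0
... | no  _ = coeff-applyUpTo c (g ∘ suc) e m k l eq (suc-injective ∘ inj)

-- A form of `∂mono` free of its `with` clauses, in which the entries of a bumped exponent can be
-- rewritten.
∂mono-unfold : ∀ i c (e : Vec ℕ n) → ∂mono i (c , e) ≡
  (if get (suc i) e ≤ᵇ get i e
   then applyUpTo (λ k → c , set2 i (get i e ∸ 1 ∸ k) (get (suc i) e + k) e) (get i e ∸ get (suc i) e)
   else applyUpTo (λ k → ℤ.- c , set2 i (get (suc i) e ∸ 1 ∸ k) (get i e + k) e) (get (suc i) e ∸ get i e))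
∂mono-unfold i c e with get (suc i) e ≤ᵇ get i e
... | true  = map-applyUpTo id _ _
... | false = map-applyUpTo id _ _

-- A term c x^e with e_i ≥ e_{i+1} gives the full string from e to s_i e; one with
-- e_i < e_{i+1} gives at most the interior of that string, with coefficient −c.
data Expansion (i : ℕ) (c : ℤ) (e : Vec ℕ n) : Poly n → Set where
  string : ∀ d (g : ℕ → Vec ℕ n) → get i e ≡ get (suc i) e + d →
           (∀ k → g k ≡ set2 i (get i e ∸ k) (get (suc i) e + k) e) →
           Expansion i c e (applyUpTo (λ k → c , g k) (suc d))
  inner  : ∀ {f} → get i e < get (suc i) e → All (λ t → norm² (proj₂ t) < norm² e) f → Expansion i c e f

norm²-on-string : ∀ d k (e : Vec ℕ n) → suc i < n → get i e ≡ get (suc i) e + d → k ≤ d →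
                 norm² (set2 i (get i e ∸ k) (get (suc i) e + k) e) + 2 * ((d ∸ k) * k) ≡ norm² e
norm²-on-string {i = i} d k e l eq k≤d = trans
  (cong (λ x → norm² (set2 i x (q + k) e) + 2 * ((d ∸ k) * k)) (trans (cong (_∸ k) eq) (+-∸-assoc q k≤d)))
  (norm²-string q (d ∸ k) k e l (cong (λ x → x * x + q * q)
    (trans eq (trans (cong (q +_) (sym (m∸n+n≡m k≤d))) (sym (+-assoc q (d ∸ k) k))))))
  where q = get (suc i) e

-- With p = `get i e` the new pair is (p + u, p + v) for u = `m ∸ k` and v = `suc k`. Both are
-- positive, hence so is the loss 2uv.
norm²-inner : ∀ m k (e : Vec ℕ n) → suc i < n → get (suc i) e ≡ suc (get i e) + m → k < m →
             norm² (set2 i (get (suc i) e ∸ 1 ∸ k) (suc (get i e) + k) e) < norm² e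
norm²-inner {i = i} m k e l eq k<m = subst₂ (λ x y → norm² (set2 i x y e) < norm² e)
  (sym x≡) (+-suc p k)
  (<-≤-trans (m<m+n _ (*-mono-≤ {1} {2} (s≤s z≤n) (*-mono-≤ {1} {m ∸ k} {1} {suc k} (m<n⇒0<n∸m k<m) (s≤s z≤n))))
    (≤-reflexive (norm²-string p (m ∸ k) (suc k) e l
      (trans (+-comm (p * p) _) (cong (λ x → x * x + p * p) (trans eq q≡))))))
  where
  p = get i e
  x≡ : get (suc i) e ∸ 1 ∸ k ≡ p + (m ∸ k)
  x≡ = trans (cong (λ x → x ∸ 1 ∸ k) eq) (+-∸-assoc p (<⇒≤ k<m))
  q≡ : suc p + m ≡ p + (m ∸ k) + suc k
  q≡ = begin
    suc (p + m)               ≡⟨ cong (λ x → suc (p + x)) (m∸n+n≡m (<⇒≤ k<m)) ⟨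
    suc (p + (m ∸ k + k))     ≡⟨ cong suc (+-assoc p _ k) ⟨
    suc (p + (m ∸ k) + k)     ≡⟨ +-suc _ k ⟨
    p + (m ∸ k) + suc k       ∎
    where open ≡-Reasoning

π-expand : ∀ i c (e : Vec ℕ n) → suc i < n → Expansion i c e (∂mono i (c , bump i e))
π-expand i c e l
  rewrite ∂mono-unfold i c (bump i e) | get-bumpˡ e l | get-bumpʳ i e
  with get (suc i) e ≤? get i e
... | yes q≤p with get (suc i) e ≤ᵇ suc (get i e) in b
...   | false = contradiction (subst T b (≤⇒≤ᵇ (m≤n⇒m≤1+n q≤p))) (λ ())
-- The factor x_i adds one term to the string of ∂_i, so that it reaches both e and s_i e.
...   | true  rewrite +-∸-assoc 1 q≤p =
  string _ _ (sym (m+[n∸m]≡n q≤p)) (λ k → set2-bump i _ _ e)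
π-expand i c e l | no q≰p with get (suc i) e ≤ᵇ suc (get i e) in b
-- Here e_{i+1} = e_i + 1: after the bump the two entries agree, and the term is killed.
...   | true  rewrite m≤n⇒m∸n≡0 (≰⇒> q≰p) = inner (≰⇒> q≰p) []
...   | false = inner (≰⇒> q≰p) (All.applyUpTo⁺₁ _ _ λ {k} k<m →
  subst (λ g → norm² g < norm² e) (sym (set2-bump i _ _ e))
        (norm²-inner _ k e l (sym (m+[n∸m]≡n (≰⇒> q≰p))) k<m))

π-norm² : ∀ N (f : Poly n) → suc i < n → All (λ t → norm² (proj₂ t) ≤ N) f → All (λ t → norm² (proj₂ t) ≤ N) (π i f)
π-norm² N []            l []       = []
π-norm² {i = i} N ((c , e) ∷ f) l (p ∷ ps) = All.++⁺ (bound (π-expand i c e l)) (π-norm² N f l ps)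
  where
  bound : ∀ {h} → Expansion i c e h → All (λ t → norm² (proj₂ t) ≤ N) h
  bound (inner _ below)    = All.map (λ q → ≤-trans (<⇒≤ q) p) below
  bound (string d g eq g≡) = All.applyUpTo⁺₁ (λ k → c , g k) (suc d) λ {k} k<1+d →
    ≤-trans (m+n≤o⇒m≤o _ (≤-reflexive (trans (cong (λ x → norm² x + _) (g≡ k)) (norm²-on-string d k e l eq (ℕ.s≤s⁻¹ k<1+d))))) p

-- The h of the overview as a relation. Ties fall under `keep`, so exactly one constructor applies
-- to each `b`.
data Dominant (i : ℕ) (b : Vec ℕ n) : Vec ℕ n → Set where
  keep : get (suc i) b ≤ get i b → Dominant i b b
  swap : get i b < get (suc i) b → Dominant i b (swapAdj i b)

dominant-≤ : ∀ {b h : Vec ℕ n} → suc i < n → Dominant i b h → get (suc i) h ≤ get i h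
dominant-≤ l (keep q) = q
dominant-≤ {b = b} l (swap p) = subst₂ _≤_ (sym (get-swapʳ b l)) (sym (get-swapˡ b l)) (<⇒≤ p)

-- Terms strictly inside a string have norm below that of `e`, hence cannot be `b`. What remains are
-- the ends e and s_i e of a full string, where e is the dominant one; so `b` occurs exactly when
-- `e` is `h`, and then once.
coeff-term : ∀ c {e b h : Vec ℕ n} {f} → suc i < n → Dominant i b h → norm² e ≤ norm² b → Expansion i c e f →
             coeff f b ≡ coeff ((c , e) ∷ []) h
coeff-term c {e} {b} {h} l D N x with ≡-dec ℕ._≟_ e h
coeff-term c l D N (inner p _) | yes refl = contradiction (dominant-≤ l D) (<⇒≱ p)
coeff-term {i = i} c {e} {b} l D N (string d g eq g≡) | yes refl = trans (occurs D) (sym (ℤ.+-identityʳ c))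
  where
  -- The entry at `suc i` increases by one along the string and so recovers the index.
  injective : ∀ {j k} → g j ≡ g k → j ≡ k
  injective {j} {k} gj≡gk = +-cancelˡ-≡ (get (suc i) e) j k
    (trans (sym (entry j)) (trans (cong (get (suc i)) gj≡gk) (entry k)))
    where
    entry : ∀ k → get (suc i) (g k) ≡ get (suc i) e + k
    entry k = trans (cong (get (suc i)) (g≡ k)) (get-set2ʳ _ _ e l)
  occurs : Dominant i b e → coeff (applyUpTo (λ k → c , g k) (suc d)) b ≡ c
  occurs (keep _) = coeff-applyUpTo c g b (suc d) 0 (s≤s z≤n)
    (trans (g≡ 0) (trans (cong (λ x → set2 i (get i e) x e) (+-identityʳ _)) (set2-get e l))) injective
  occurs (swap _) = coeff-applyUpTo c g b (suc d) d ≤-refl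
    (trans (g≡ d) (trans (cong₂ (λ x y → set2 i x y e) (trans (cong (_∸ d) eq) (m+n∸n≡m _ d)) (sym eq)) (swapAdj-involutive b l))) injective
coeff-term {i = i} c {e} {b} l D N x | no e≢h = coeff-absent _ b (absent x)
  where
  absent : ∀ {f} → Expansion i c e f → All (λ t → proj₂ t ≢ b) f
  absent (inner _ below) = All.map (λ q g≡b → <⇒≱ q (subst (λ g → norm² e ≤ norm² g) (sym g≡b) N)) below
  absent (string d g eq g≡) = All.applyUpTo⁺₁ (λ k → c , g k) (suc d) λ {k} k<1+d gk≡b → hit k (ℕ.s≤s⁻¹ k<1+d) (trans (sym gk≡b) (g≡ k)) D e≢h
    where
    start : ∀ {h} → b ≡ e → Dominant i b h → ¬ e ≢ h
    start refl (keep _) e≢h = e≢h refl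
    start refl (swap p) _   = <⇒≱ p (m+n≤o⇒m≤o _ (≤-reflexive (sym eq)))
    hit : ∀ {h} k → k ≤ d → b ≡ set2 i (get i e ∸ k) (get (suc i) e + k) e → Dominant i b h → ¬ e ≢ h
    hit zero _ b≡ = start (trans b≡ (trans (cong (λ x → set2 i (get i e) x e) (+-identityʳ _)) (set2-get e l)))
    -- If the index is not the last one, both factors of the loss are positive, which contradicts
    -- `N`; otherwise `b` is the far end s_i e.
    hit (suc k) k≤d b≡ D e≢h with d ∸ suc k in d∸k | norm²-on-string d (suc k) e l eq k≤d
    ... | suc u | N≡ = <⇒≱ (<-≤-trans (m<m+n (norm² b) (s≤s z≤n)) (≤-reflexive (trans (cong (λ x → norm² x + _) b≡) N≡))) N
    ... | zero  | _  = end D e≢h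
      where
      d≡ : suc k ≡ d
      d≡ = ≤-antisym k≤d (m∸n≡0⇒m≤n d∸k)
      b≡s : b ≡ swapAdj i e
      b≡s = trans b≡ (cong₂ (λ x y → set2 i x y e)
        (trans (cong₂ _∸_ eq d≡) (m+n∸n≡m _ d)) (trans (cong (get (suc i) e +_) d≡) (sym eq)))
      end : ∀ {h} → Dominant i b h → ¬ e ≢ h
      end (swap _) e≢h = e≢h (sym (trans (cong (swapAdj i) b≡s) (swapAdj-involutive e l)))
      -- A far end that is itself dominant forces d = 0, but the index `suc k` is at most d.
      end (keep p) _   = <⇒≱ (m<m+n (get (suc i) e) (≤-trans (s≤s z≤n) k≤d))
        (subst (_≤ get (suc i) e) eq (subst₂ _≤_ (trans (cong (get (suc i)) b≡s) (get-swapʳ e l)) (trans (cong (get i) b≡s) (get-swapˡ e l)) p))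

coeff-π : ∀ (f : Poly n) {b h} → suc i < n → Dominant i b h → All (λ t → norm² (proj₂ t) ≤ norm² b) f →
          coeff (π i f) b ≡ coeff f h
coeff-π []            l D []       = refl
coeff-π {i = i} ((c , e) ∷ f) {b} {h} l D (p ∷ ps) = begin
  coeff (∂mono i (c , bump i e) ++ π i f) b             ≡⟨ coeff-++ (∂mono i (c , bump i e)) (π i f) b ⟩
  coeff (∂mono i (c , bump i e)) b ℤ.+ coeff (π i f) b  ≡⟨ cong₂ ℤ._+_ (coeff-term c l D p (π-expand i c e l)) (coeff-π f l D ps) ⟩
  coeff ((c , e) ∷ []) h ℤ.+ coeff f h                  ≡⟨ coeff-++ ((c , e) ∷ []) f h ⟨
  coeff ((c , e) ∷ f) h                                 ∎
  where open ≡-Reasoning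

-- Extremal coefficients of key polynomials

-- All pairs of positions, adjacent or not, whose left entry is the smaller one. This is the number
-- of recursive steps that `keyF` takes.
ascents : Vec ℕ n → ℕ
ascents []              = 0
ascents {suc n} (a ∷ v) = atLeast (suc a) n v + ascents v

ascents-≤ : (v : Vec ℕ n) → ascents v ≤ n * n
ascents-≤ []              = z≤n
ascents-≤ {suc n} (a ∷ v) =
  ≤-trans (+-mono-≤ (atLeast-≤ (suc a) n v) (ascents-≤ v)) (*-monoʳ-≤ (suc n) (n≤1+n n))

-- The swapped pair is the only one whose relative order changes.
ascents-swap : (v : Vec ℕ n) → suc i < n → get i v < get (suc i) v → ascents v ≡ suc (ascents (swapAdj i v))
ascents-swap {i = zero} (a ∷ [])    (s≤s ()) _
ascents-swap {n = suc (suc n)} {i = zero} (a ∷ b ∷ v) _ a<b with suc a ≤? b | suc b ≤? a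
... | no a≮b | _       = contradiction a<b a≮b
... | yes _  | yes b<a = contradiction b<a (<-asym a<b)
... | yes _  | no _    = cong suc (+-swap (atLeast (suc a) n v) (atLeast (suc b) n v) (ascents v))
ascents-swap {n = suc n} {i = suc i} (a ∷ v) (s≤s l) lt =
  trans (cong₂ _+_ (sym (atLeast-swap (suc a) n v l (λ eq → <-irrefl (sym eq) l))) (ascents-swap v l lt)) (+-suc _ _)

data FirstAscent (v : Vec ℕ n) : Maybe ℕ → Set where
  ascent : ∀ {i} → suc i < n → get i v < get (suc i) v → FirstAscent v (just i)
  none   : Linked ℕ._≥_ v → FirstAscent v nothing

firstAscent-spec : (v : Vec ℕ n) → FirstAscent v (firstAscent v)
firstAscent-spec []          = none []
firstAscent-spec (a ∷ [])    = none [-]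
firstAscent-spec (a ∷ b ∷ v) with firstAscent (b ∷ v) | firstAscent-spec (b ∷ v) | a <ᵇ b in eq
... | _ | _          | true  = ascent (s≤s (s≤s z≤n)) (<ᵇ⇒< a b (subst T (sym eq) tt))
... | _ | ascent l l′ | false = ascent (s≤s l) l′
... | _ | none ds    | false = none (≮⇒≥ (λ a<b → subst T eq (<⇒<ᵇ a<b)) ∷ ds)

atLeast-above : ∀ t k a (v : Vec ℕ n) → Linked ℕ._≥_ (a ∷ v) → a < t → atLeast t k (a ∷ v) ≡ 0
atLeast-above t zero    a v ds a<t = refl
atLeast-above t (suc k) a v ds a<t with t ≤? a
... | yes t≤a = contradiction t≤a (<⇒≱ a<t)
atLeast-above t (suc zero)    a v       ds         a<t | no _ = refl
atLeast-above t (suc (suc k)) a []      ds         a<t | no _ = refl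
atLeast-above t (suc (suc k)) a (b ∷ v) (b≤a ∷ ds) a<t | no _ = atLeast-above t (suc k) b v ds (≤-<-trans b≤a a<t)

-- The tableau criterion for Bruhat order, stated on words instead of permutations.
_Dominates_ : Vec ℕ n → Vec ℕ n → Set
β Dominates α = ∀ t k → atLeast t k α ≤ atLeast t k β

_SameEntries_ : Vec ℕ n → Vec ℕ n → Set
_SameEntries_ {n} β α = ∀ t → atLeast t n β ≡ atLeast t n α

𝟙-yes : ∀ {P : Set} (P? : Dec P) → P → 𝟙 P? ≡ 1
𝟙-yes (yes _) _ = refl
𝟙-yes (no ¬p) p = contradiction p ¬p

-- The prefix of length 1 at threshold `a` gives `a ≤ b`. Conversely `a < b` would leave α, whose
-- maximum is `a`, without an entry ≥ `b`, though β has one. Once the equal heads are cancelled, the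
-- tails satisfy the same hypotheses.
dominates-decreasing : (β α : Vec ℕ n) → Linked ℕ._≥_ α → β Dominates α → β SameEntries α → β ≡ α
dominates-decreasing []      []      _  _ _ = refl
dominates-decreasing {suc n} (b ∷ β) (a ∷ α) ds D E with ≤-antisym a≤b b≤a
  where
  a≤b : a ≤ b
  a≤b with a ≤? b | D a 1
  ... | yes p | _ = p
  ... | no _  | q rewrite 𝟙-yes (a ≤? a) ≤-refl = contradiction q λ ()
  b≤a : b ≤ a
  b≤a = ≮⇒≥ λ a<b → 0≢1+n (trans (sym (atLeast-above b (suc n) a α ds a<b))
    (trans (sym (E b)) (cong (_+ atLeast b n β) (𝟙-yes (b ≤? b) ≤-refl))))
... | refl = cong (a ∷_) (dominates-decreasing β α (tail ds)
    (λ t k → +-cancelˡ-≤ (𝟙 (t ≤? a)) _ _ (D t (suc k)))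
    (λ t → +-cancelˡ-≡ (𝟙 (t ≤? a)) _ _ (E t)))
  where
  tail : ∀ {n a} {v : Vec ℕ n} → Linked ℕ._≥_ (a ∷ v) → Linked ℕ._≥_ v
  tail [-]      = []
  tail (_ ∷ ds) = ds

-- The lifting property of Bruhat order.
dominates-swap : ∀ (α β : Vec ℕ n) {h} → suc i < n → Dominant i β h → β Dominates α → h Dominates (swapAdj i α)
dominates-swap {n} {i} α β {h} l dom D t k with k ℕ.≟ suc i
... | no k≢ = ≤-trans (≤-reflexive (atLeast-swap t k α l k≢)) (≤-trans (D t k) (≤-reflexive (sym (same dom))))
  where
  same : ∀ {h} → Dominant i β h → atLeast t k h ≡ atLeast t k β
  same (keep _) = refl
  same (swap _) = atLeast-swap t k β l k≢
... | yes refl = ≤-trans (≤-reflexive (atLeast-swap-at t α l)) (at dom)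
  where
  i<n = <-trans (n<1+n i) l
  A = atLeast t i α
  B = atLeast t i β
  two : ∀ v → atLeast t (suc (suc i)) v ≡ atLeast t i v + 𝟙 (t ≤? get i v) + 𝟙 (t ≤? get (suc i) v)
  two v = trans (atLeast-suc t (suc i) v l) (cong (_+ 𝟙 (t ≤? get (suc i) v)) (atLeast-suc t i v i<n))
  -- The prefix of length i+1 of `h` ends in the larger entry `m` of the pair. If `m` is below t,
  -- neither entry of the pair in β counts, and domination at length i+2 gives the bound; otherwise
  -- length i suffices.
  max : ∀ m → get i β ≤ m → get (suc i) β ≤ m → A + 𝟙 (t ≤? get (suc i) α) ≤ B + 𝟙 (t ≤? m)
  max m b≤m b′≤m with t ≤? get (suc i) α | t ≤? m | subst₂ _≤_ (two α) (two β) (D t (suc (suc i)))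
  ... | no _  | _      | _ = +-mono-≤ (D t i) z≤n
  ... | yes _ | yes _  | _ = +-monoˡ-≤ 1 (D t i)
  ... | yes p | no t≰m | q with t ≤? get i β | t ≤? get (suc i) β | t ≤? get (suc i) α
  ...   | yes r | _     | _     = contradiction (≤-trans r b≤m) t≰m
  ...   | no _  | yes r | _     = contradiction (≤-trans r b′≤m) t≰m
  ...   | no _  | no _  | no ¬p = contradiction p ¬p
  ...   | no _  | no _  | yes _ = ≤-trans (+-monoˡ-≤ 1 (m≤m+n A _)) (≤-trans q (≤-reflexive (+-identityʳ _)))
  at : ∀ {h} → Dominant i β h → A + 𝟙 (t ≤? get (suc i) α) ≤ atLeast t (suc i) h
  at (keep b′≤b) = ≤-trans (max _ ≤-refl b′≤b) (≤-reflexive (sym (atLeast-suc t i β i<n)))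
  at (swap b<b′) = ≤-trans (max _ (<⇒≤ b<b′) ≤-refl) (≤-reflexive (sym (atLeast-swap-at t β l)))

atLeast-swap-all : ∀ t (v : Vec ℕ n) → suc i < n → atLeast t n (swapAdj i v) ≡ atLeast t n v
atLeast-swap-all t v l = atLeast-swap t _ v l (λ eq → <-irrefl (sym eq) l)

key-norm² : ∀ fuel (α : Vec ℕ n) → All (λ t → norm² (proj₂ t) ≤ norm² α) (keyF fuel α)
key-norm² fuel α with firstAscent α | firstAscent-spec α
key-norm² fuel       α | _ | none _     = ≤-refl ∷ []
key-norm² zero       α | _ | ascent l _ = []
key-norm² (suc fuel) α | _ | ascent {i} l _ = π-norm² _ (keyF fuel (swapAdj i α)) l
  (subst (λ N → All (λ t → norm² (proj₂ t) ≤ N) (keyF fuel (swapAdj i α))) (norm²-swap α l) (key-norm² fuel (swapAdj i α)))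

dominant : ∀ i (b : Vec ℕ n) → ∃[ h ] Dominant i b h
dominant i b with get (suc i) b ≤? get i b
... | yes q = b , keep q
... | no ¬q = swapAdj i b , swap (≰⇒> ¬q)

-- Follows the recursion of `keyF`, replacing α by s_i α and β by its dominant form. Equality of
-- norms makes `coeff-π` applicable at each step; at a decreasing α the hypotheses force β = α.
key-coeff : ∀ fuel (α β : Vec ℕ n) → ascents α ≤ fuel → β Dominates α → β SameEntries α → norm² β ≡ norm² α →
            coeff (keyF fuel α) β ≡ ℤ.1ℤ
key-coeff fuel α β _ D E _ with firstAscent α | firstAscent-spec α
key-coeff fuel α β _ D E _ | _ | none ds with dominates-decreasing β α ds D E
... | refl with ≡-dec ℕ._≟_ β β
...   | yes _ = refl
...   | no ¬p = contradiction refl ¬p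
key-coeff zero α β F D E _ | _ | ascent l lt = contradiction (trans (sym (ascents-swap α l lt)) (n≤0⇒n≡0 F)) λ ()
key-coeff {n} (suc fuel) α β F D E N | _ | ascent {i} l lt with dominant i β
... | h , dom = trans
  (coeff-π (keyF fuel (swapAdj i α)) l dom
    (subst (λ N → All (λ t → norm² (proj₂ t) ≤ N) (keyF fuel (swapAdj i α))) (trans (norm²-swap α l) (sym N)) (key-norm² fuel (swapAdj i α))))
  (key-coeff fuel (swapAdj i α) h (ℕ.s≤s⁻¹ (subst (_≤ suc fuel) (ascents-swap α l lt) F))
    (dominates-swap α β l dom D)
    (λ t → trans (same t dom) (trans (E t) (sym (atLeast-swap-all t α l))))
    (trans (norm²≡ dom) (trans N (sym (norm²-swap α l)))))
  where
  same : ∀ t {h} → Dominant i β h → atLeast t n h ≡ atLeast t n β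
  same t (keep _) = refl
  same t (swap _) = atLeast-swap-all t β l
  norm²≡ : ∀ {h} → Dominant i β h → norm² h ≡ norm² β
  norm²≡ (keep _) = refl
  norm²≡ (swap _) = norm²-swap β l

-- Invariance under sorting

atLeast-insertDec : ∀ t a (v : Vec ℕ n) → atLeast t (suc n) (insertDec a v) ≡ 𝟙 (t ≤? a) + atLeast t n v
atLeast-insertDec t a []      = refl
atLeast-insertDec {suc n} t a (b ∷ v) with b ≤ᵇ a
... | true  = refl
... | false = trans (cong (𝟙 (t ≤? b) +_) (atLeast-insertDec t a v)) (+-swap (𝟙 (t ≤? b)) (𝟙 (t ≤? a)) _)

atLeast-sortDec : ∀ t (v : Vec ℕ n) → atLeast t n (sortDec v) ≡ atLeast t n v
atLeast-sortDec t []      = refl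
atLeast-sortDec t (a ∷ v) = trans (atLeast-insertDec t a (sortDec v)) (cong (𝟙 (t ≤? a) +_) (atLeast-sortDec t v))

norm²-insertDec : ∀ a (v : Vec ℕ n) → norm² (insertDec a v) ≡ a * a + norm² v
norm²-insertDec a []      = refl
norm²-insertDec a (b ∷ v) with b ≤ᵇ a
... | true  = refl
... | false = trans (cong (b * b +_) (norm²-insertDec a v)) (+-swap (b * b) (a * a) _)

norm²-sortDec : (v : Vec ℕ n) → norm² (sortDec v) ≡ norm² v
norm²-sortDec []      = refl
norm²-sortDec (a ∷ v) = trans (norm²-insertDec a (sortDec v)) (cong (a * a +_) (norm²-sortDec v))

-- Bruhat order

sum-mono : {f g : Fin n → ℕ} → (∀ a → f a ≤ g a) → sum f ≤ sum g
sum-mono {zero}  f≤g = z≤n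
sum-mono {suc n} f≤g = +-mono-≤ (f≤g zero) (sum-mono (f≤g ∘ suc))

-- Averaging over σ reduces the inequality to a pointwise one, which says that
-- x and y change in the same direction under σ.
module Rearrangement {A : Set} (S : (A → ℕ) → ℕ)
  (S-+    : ∀ f g → S (λ a → f a + g a) ≡ S f + S g)
  (S-mono : ∀ {f g} → (∀ a → f a ≤ g a) → S f ≤ S g)
  (σ : A → A) (σ-involutive : ∀ a → σ (σ a) ≡ a) (S-σ : ∀ f → S f ≡ S (f ∘ σ))
  where

  rearrangement : ∀ (x y : A → ℕ) → (∀ a → x a * y (σ a) + x (σ a) * y a ≤ x a * y a + x (σ a) * y (σ a)) →
                  S (λ a → x a * y (σ a)) ≤ S (λ a → x a * y a)
  -- The doubled sums are compared, so the opposite strict inequality is added to itself.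
  rearrangement x y local = ≮⇒≥ λ lt → <⇒≱ (+-mono-< lt lt) (begin
    S f + S f                ≡⟨ cong (S f +_) (S-σ f) ⟩
    S f + S (f ∘ σ)          ≡⟨ S-+ f (f ∘ σ) ⟨
    S (λ a → f a + f (σ a))  ≤⟨ S-mono (λ a → ≤-trans (≤-reflexive (cong (λ b → f a + x (σ a) * y b) (σ-involutive a))) (local a)) ⟩
    S (λ a → g a + g (σ a))  ≡⟨ S-+ g (g ∘ σ) ⟩
    S g + S (g ∘ σ)          ≡⟨ cong (S g +_) (S-σ g) ⟨
    S g + S g                ∎)
    where
    open ≤-Reasoning
    f g : A → ℕ
    f a = x a * y (σ a)
    g a = x a * y a

-- The two sides agree unless exactly one of P, P′ holds; then a single term survives on each side
-- and one of the two implications compares them.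
𝟙-comonotone : ∀ {P P′ Q Q′ : Set} (P? : Dec P) (P′? : Dec P′) (Q? : Dec Q) (Q′? : Dec Q′) →
               (P → ¬ P′ → Q′ → Q) → (P′ → ¬ P → Q → Q′) →
               𝟙 P? * 𝟙 Q′? + 𝟙 P′? * 𝟙 Q? ≤ 𝟙 P? * 𝟙 Q? + 𝟙 P′? * 𝟙 Q′?
𝟙-comonotone (no _)  (no _)   Q?      Q′?      f g = z≤n
𝟙-comonotone (yes _) (yes _)  Q?      Q′?      f g = ≤-reflexive (+-comm (1 * 𝟙 Q′?) _)
𝟙-comonotone (yes p) (no ¬p′) Q?      Q′?      f g = +-monoˡ-≤ 0 (*-monoʳ-≤ 1 (𝟙-mono Q′? Q? (f p ¬p′)))
𝟙-comonotone (no ¬p) (yes p′) Q?      Q′?      f g = *-monoʳ-≤ 1 (𝟙-mono Q? Q′? (g p′ ¬p))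

transpose-cases : ∀ (i j k : Fin n) → let τ = transpose i j ⟨$⟩ʳ_ in
  (k ≡ i × τ k ≡ j) ⊎ (k ≡ j × τ k ≡ i) ⊎ (k ≢ i × k ≢ j × τ k ≡ k)
transpose-cases i j k with k Fin.≟ i
... | yes p = inj₁ (p , refl)
... | no ¬p with k Fin.≟ j
...   | yes q = inj₂ (inj₁ (q , refl))
...   | no ¬q = inj₂ (inj₂ (¬p , ¬q , refl))

transpose-ˡ : ∀ (i j : Fin n) → transpose i j ⟨$⟩ʳ i ≡ j
transpose-ˡ i j with transpose-cases i j i
... | inj₁ (_ , e)                  = e
... | inj₂ (inj₁ (i≡j , e))         = trans e i≡j
... | inj₂ (inj₂ (i≢i , _))         = contradiction refl i≢i

transpose-ʳ : ∀ (i j : Fin n) → transpose i j ⟨$⟩ʳ j ≡ i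
transpose-ʳ i j with transpose-cases i j j
... | inj₁ (j≡i , e)                = trans e j≡i
... | inj₂ (inj₁ (_ , e))           = e
... | inj₂ (inj₂ (_ , j≢j , _))     = contradiction refl j≢j

transpose-involutive : ∀ (i j k : Fin n) → transpose i j ⟨$⟩ʳ (transpose i j ⟨$⟩ʳ k) ≡ k
transpose-involutive i j k with transpose-cases i j k
... | inj₁ (k≡i , e)            = trans (cong (transpose i j ⟨$⟩ʳ_) e) (trans (transpose-ʳ i j) (sym k≡i))
... | inj₂ (inj₁ (k≡j , e))     = trans (cong (transpose i j ⟨$⟩ʳ_) e) (trans (transpose-ˡ i j) (sym k≡j))
... | inj₂ (inj₂ (_ , _ , e))   = trans (cong (transpose i j ⟨$⟩ʳ_) e) e

transpose-comm : ∀ (i j k : Fin n) → transpose i j ⟨$⟩ʳ k ≡ transpose j i ⟨$⟩ʳ k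
transpose-comm i j k with transpose-cases i j k
... | inj₁ (k≡i , e)            = trans e (sym (trans (cong (transpose j i ⟨$⟩ʳ_) k≡i) (transpose-ʳ j i)))
... | inj₂ (inj₁ (k≡j , e))     = trans e (sym (trans (cong (transpose j i ⟨$⟩ʳ_) k≡j) (transpose-ˡ j i)))
... | inj₂ (inj₂ (k≢i , k≢j , e)) with transpose-cases j i k
...   | inj₁ (k≡j , _)          = contradiction k≡j k≢j
...   | inj₂ (inj₁ (k≡i , _))   = contradiction k≡i k≢i
...   | inj₂ (inj₂ (_ , _ , e′)) = trans e (sym e′)

inversion : Perm n → Fin n × Fin n → ℕ
inversion u (a , b) = 𝟙 (a Fin.<? b) * 𝟙 ((u ⟨$⟩ʳ b) Fin.<? (u ⟨$⟩ʳ a))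

sum² : (Fin n × Fin n → ℕ) → ℕ
sum² f = sum (λ a → sum (λ b → f (a , b)))

sumℕ-allFin : (f : Fin n → ℕ) → sumℕ (List.map f (allFin n)) ≡ sum f
sumℕ-allFin f = trans (cong sumℕ (map-tabulate id f)) (go f)
  where
  go : ∀ {n} (f : Fin n → ℕ) → sumℕ (tabulate f) ≡ sum f
  go {zero}  f = refl
  go {suc n} f = cong (f zero +_) (go (f ∘ suc))

-- Unification recovers the summand of invCount, which is local to its definition.
invCount-summand : Σ (Perm n → Fin n → Fin n → ℕ) λ c → (∀ (u : Perm n) → invCount u ≡ sumℕ (List.map (λ a → sumℕ (List.map (λ b → c u a b) (allFin n))) (allFin n)))
invCount-summand = _ , λ u → refl

invCount-summand-≡ : ∀ (u : Perm n) a b → proj₁ invCount-summand u a b ≡ inversion u (a , b)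
invCount-summand-≡ u a b with a Fin.<? b | (u ⟨$⟩ʳ b) Fin.<? (u ⟨$⟩ʳ a)
... | yes _ | yes _ = refl
... | yes _ | no _  = refl
... | no _  | yes _ = refl
... | no _  | no _  = refl

len-sum² : (u : Perm n) → len u ≡ sum² (inversion u)
len-sum² {n} u = trans (proj₂ invCount-summand u) (trans
  (sumℕ-allFin (λ a → sumℕ (List.map (c a) (allFin n))))
  (sum-cong-≗ λ a → trans (sumℕ-allFin (c a)) (sum-cong-≗ λ b → invCount-summand-≡ u a b)))
  where c = proj₁ invCount-summand u

-- The length sums, over pairs of positions, `x` (order of positions) times `y` (inversion of
-- values). Passing from `u` to `v` composes only `y` with the transposition, so the rearrangement
-- inequality applies.
len-swap-inverted : ∀ (u v : Perm n) {i j} → i Fin.< j → (u ⟨$⟩ʳ j) Fin.< (u ⟨$⟩ʳ i) →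
                    (∀ k → v ⟨$⟩ʳ k ≡ u ⟨$⟩ʳ (transpose i j ⟨$⟩ʳ k)) → len v ≤ len u
len-swap-inverted {n} u v {i} {j} i<j uj<ui v≡ = begin
  len v                                  ≡⟨ len-sum² v ⟩
  sum² (inversion v)                     ≡⟨ sum-cong-≗ (λ a → sum-cong-≗ λ b → cong₂ (λ p q → 𝟙 (a Fin.<? b) * 𝟙 (p Fin.<? q)) (v≡ b) (v≡ a)) ⟩
  sum² (λ c → x c * y (σ c))             ≤⟨ rearrangement x y (λ (a , b) → 𝟙-comonotone (a Fin.<? b) (τ a Fin.<? τ b)
                                              ((u ⟨$⟩ʳ b) Fin.<? (u ⟨$⟩ʳ a)) ((u ⟨$⟩ʳ τ b) Fin.<? (u ⟨$⟩ʳ τ a))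
                                              (exit a b) (enter a b)) ⟩
  sum² (inversion u)                     ≡⟨ len-sum² u ⟨
  len u                                  ∎
  where
  open ≤-Reasoning
  τ : Fin n → Fin n
  τ = transpose i j ⟨$⟩ʳ_
  ττ : ∀ a → τ (τ a) ≡ a
  ττ = transpose-involutive i j
  σ : Fin n × Fin n → Fin n × Fin n
  σ (a , b) = τ a , τ b
  x y : Fin n × Fin n → ℕ
  x (a , b) = 𝟙 (a Fin.<? b)
  y (a , b) = 𝟙 ((u ⟨$⟩ʳ b) Fin.<? (u ⟨$⟩ʳ a))
  open Rearrangement sum²
    (λ f g → trans (sum-cong-≗ λ a → ∑-distrib-+ (λ b → f (a , b)) (λ b → g (a , b)))
                   (∑-distrib-+ (λ a → sum (λ b → f (a , b))) (λ a → sum (λ b → g (a , b)))))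
    (λ f≤g → sum-mono λ a → sum-mono λ b → f≤g (a , b))
    σ (λ (a , b) → cong₂ _,_ (ττ a) (ττ b))
    (λ f → trans (sum-permute (λ a → sum (λ b → f (a , b))) (transpose i j))
                 (sum-cong-≗ λ a → sum-permute (λ b → f (τ a , b)) (transpose i j)))
  -- A pair a < b loses its order under τ only if a = i or b = j; there `uj<ui` supplies the
  -- inversion or extends the given one.
  exit : ∀ a b → a Fin.< b → ¬ τ a Fin.< τ b → (u ⟨$⟩ʳ τ b) Fin.< (u ⟨$⟩ʳ τ a) → (u ⟨$⟩ʳ b) Fin.< (u ⟨$⟩ʳ a)
  exit a b a<b ¬τ lt with transpose-cases i j a | transpose-cases i j b
  ... | inj₁ (refl , ea)        | inj₁ (refl , _)         = contradiction a<b (n≮n _)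
  ... | inj₁ (refl , ea)        | inj₂ (inj₁ (refl , _))  = uj<ui
  ... | inj₁ (refl , ea)        | inj₂ (inj₂ (_ , _ , eb)) rewrite ea | eb = <-trans lt uj<ui
  ... | inj₂ (inj₁ (refl , _))  | inj₁ (refl , _)         = contradiction i<j (<-asym a<b)
  ... | inj₂ (inj₁ (refl , _))  | inj₂ (inj₁ (refl , _))  = contradiction a<b (n≮n _)
  ... | inj₂ (inj₁ (refl , ea)) | inj₂ (inj₂ (_ , _ , eb)) rewrite ea | eb = contradiction (<-trans i<j a<b) ¬τ
  ... | inj₂ (inj₂ (_ , _ , ea)) | inj₁ (refl , eb) rewrite ea | eb = contradiction (<-trans a<b i<j) ¬τ
  ... | inj₂ (inj₂ (_ , _ , ea)) | inj₂ (inj₁ (refl , eb)) rewrite ea | eb = <-trans uj<ui lt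
  ... | inj₂ (inj₂ (_ , _ , ea)) | inj₂ (inj₂ (_ , _ , eb)) rewrite ea | eb = lt
  enter : ∀ a b → τ a Fin.< τ b → ¬ a Fin.< b → (u ⟨$⟩ʳ b) Fin.< (u ⟨$⟩ʳ a) → (u ⟨$⟩ʳ τ b) Fin.< (u ⟨$⟩ʳ τ a)
  enter a b lt ¬lt inv = exit (τ a) (τ b) lt
    (subst₂ (λ p q → ¬ p Fin.< q) (sym (ττ a)) (sym (ττ b)) ¬lt)
    (subst₂ (λ p q → (u ⟨$⟩ʳ q) Fin.< (u ⟨$⟩ʳ p)) (sym (ττ a)) (sym (ττ b)) inv)

⟨$⟩ʳ-injective : ∀ (u : Perm n) {i j} → u ⟨$⟩ʳ i ≡ u ⟨$⟩ʳ j → i ≡ j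
⟨$⟩ʳ-injective u eq = trans (sym (inverseˡ u)) (trans (cong (u ⟨$⟩ˡ_) eq) (inverseˡ u))

-- Since a step raises the length, `len-swap-inverted` excludes that the exchanged pair, taken in
-- increasing order, was already inverted.
bruhat-ascent : ∀ {u v : Perm n} → BruhatStep u v → ∃[ i ] ∃[ j ] i Fin.< j × (u ⟨$⟩ʳ i) Fin.< (u ⟨$⟩ʳ j)
                × (∀ k → v ⟨$⟩ʳ k ≡ u ⟨$⟩ʳ (transpose i j ⟨$⟩ʳ k))
bruhat-ascent {u = u} {v} (i , j , i≢j , v≡ , lu<lv) with Fin.<-cmp i j
... | tri< i<j _ _ = i , j , i<j , Fin.≤∧≢⇒< (≮⇒≥ λ inv → <⇒≱ lu<lv (len-swap-inverted u v i<j inv v≡)) (i≢j ∘ ⟨$⟩ʳ-injective u) , v≡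
... | tri≈ _ i≡j _ = contradiction i≡j i≢j
... | tri> _ _ j<i = j , i , j<i , Fin.≤∧≢⇒< (≮⇒≥ λ inv → <⇒≱ lu<lv (len-swap-inverted u v j<i inv v≡′)) (i≢j ∘ sym ∘ ⟨$⟩ʳ-injective u) , v≡′
  where v≡′ = λ k → trans (v≡ k) (cong (u ⟨$⟩ʳ_) (transpose-comm i j k))

-- The number of entries ≥ t among the first k of the word whose u(a)-th letter is lam(a).
placed : Vec ℕ n → ℕ → ℕ → Perm n → ℕ
placed lam t k u = sum (λ a → 𝟙 (t ≤? lookup lam a) * 𝟙 (toℕ (u ⟨$⟩ʳ a) <? k))

-- A step up moves the larger letter `lookup lam i` right, from place u(i) to u(j), and the smaller
-- one left, so no prefix gains large letters.
placed-step : ∀ (lam : Vec ℕ n) t k {u v} → Linked ℕ._≥_ lam → BruhatStep u v → placed lam t k v ≤ placed lam t k u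
placed-step {n} lam t k {u} {v} ds step with bruhat-ascent step
... | i , j , i<j , ui<uj , v≡ = begin
  placed lam t k v             ≡⟨ sum-cong-≗ (λ a → cong (λ p → x a * 𝟙 (toℕ p <? k)) (v≡ a)) ⟩
  sum (λ a → x a * y (τ a))    ≤⟨ rearrangement x y (λ a → 𝟙-comonotone (t ≤? lookup lam a) (t ≤? lookup lam (τ a))
                                    (toℕ (u ⟨$⟩ʳ a) <? k) (toℕ (u ⟨$⟩ʳ τ a) <? k) (exit a)
                                    (λ p′ ¬p q → exit′ a p′ ¬p q)) ⟩
  placed lam t k u             ∎
  where
  open ≤-Reasoning
  τ : Fin n → Fin n
  τ = transpose i j ⟨$⟩ʳ_
  x y : Fin n → ℕ
  x a = 𝟙 (t ≤? lookup lam a)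
  y a = 𝟙 (toℕ (u ⟨$⟩ʳ a) <? k)
  open Rearrangement sum ∑-distrib-+ sum-mono τ (transpose-involutive i j) (λ f → sum-permute f (transpose i j))
  λj≤λi : lookup lam j ≤ lookup lam i
  λj≤λi = lookup⁺ (λ p q → ≤-trans q p) ds i<j
  exit : ∀ a → t ≤ lookup lam a → ¬ t ≤ lookup lam (τ a) → toℕ (u ⟨$⟩ʳ τ a) < k → toℕ (u ⟨$⟩ʳ a) < k
  exit a p ¬p′ q′ with transpose-cases i j a
  ... | inj₁ (refl , e) rewrite e = <-trans ui<uj q′
  ... | inj₂ (inj₁ (refl , e)) rewrite e = contradiction (≤-trans p λj≤λi) ¬p′
  ... | inj₂ (inj₂ (_ , _ , e)) rewrite e = q′
  exit′ : ∀ a → t ≤ lookup lam (τ a) → ¬ t ≤ lookup lam a → toℕ (u ⟨$⟩ʳ a) < k → toℕ (u ⟨$⟩ʳ τ a) < k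
  exit′ a p′ ¬p q with transpose-cases i j a
  ... | inj₁ (refl , e) rewrite e = contradiction (≤-trans p′ λj≤λi) ¬p
  ... | inj₂ (inj₁ (refl , e)) rewrite e = <-trans ui<uj q
  ... | inj₂ (inj₂ (_ , _ , e)) rewrite e = q

placed-bruhat : ∀ (lam : Vec ℕ n) t k {u v} → Linked ℕ._≥_ lam → u ≤B v → placed lam t k v ≤ placed lam t k u
placed-bruhat lam t k ds ε          = ≤-refl
placed-bruhat lam t k ds (s ◅ rest) = ≤-trans (placed-bruhat lam t k ds rest) (placed-step lam t k ds s)

atLeast-sum : ∀ t k (v : Vec ℕ n) → atLeast t k v ≡ sum (λ p → 𝟙 (t ≤? lookup v p) * 𝟙 (toℕ p <? k))
atLeast-sum {zero}  t zero    []      = refl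
atLeast-sum {zero}  t (suc k) []      = refl
atLeast-sum {suc n} t zero    (a ∷ v) = cong₂ _+_ (sym (*-zeroʳ (𝟙 (t ≤? a)))) (atLeast-sum t zero v)
atLeast-sum {suc n} t (suc k) (a ∷ v) = cong₂ _+_ (sym (*-identityʳ (𝟙 (t ≤? a))))
  (trans (atLeast-sum t k v) (sum-cong-≗ λ p → cong (𝟙 (t ≤? lookup v p) *_) (𝟙-suc (toℕ p) k)))
  where
  𝟙-suc : ∀ p k → 𝟙 (p <? k) ≡ 𝟙 (suc p <? suc k)
  𝟙-suc p k = ≤-antisym (𝟙-mono (p <? k) (suc p <? suc k) s≤s) (𝟙-mono (suc p <? suc k) (p <? k) ℕ.s≤s⁻¹)

atLeast-placed : ∀ t k (lam γ : Vec ℕ n) u → Sends lam γ u → atLeast t k γ ≡ placed lam t k u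
atLeast-placed t k lam γ u S = trans (atLeast-sum t k γ) (trans
  (sum-permute (λ p → 𝟙 (t ≤? lookup γ p) * 𝟙 (toℕ p <? k)) u)
  (sum-cong-≗ λ a → cong (λ x → 𝟙 (t ≤? x) * 𝟙 (toℕ (u ⟨$⟩ʳ a) <? k)) (S a)))

-- Sorting permutations and the passage from ⪯ to prefix domination

sortDec-decreasing : (v : Vec ℕ n) → Linked ℕ._≥_ (sortDec v)
sortDec-decreasing []      = []
sortDec-decreasing (a ∷ v) = insert a (sortDec v) (sortDec-decreasing v)
  where
  head : ∀ {n} a b (v : Vec ℕ n) → a ≤ b → Linked ℕ._≥_ (b ∷ v) → Linked ℕ._≥_ (b ∷ insertDec a v)
  insert : ∀ {n} a (v : Vec ℕ n) → Linked ℕ._≥_ v → Linked ℕ._≥_ (insertDec a v)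
  insert a []      ds = [-]
  insert a (b ∷ v) ds with b ≤ᵇ a in eq
  ... | true  = ≤ᵇ⇒≤ b a (subst T (sym eq) tt) ∷ ds
  ... | false = head a b v (<⇒≤ (≰⇒> λ b≤a → subst T eq (≤⇒≤ᵇ b≤a))) ds
  head a b []      a≤b ds         = a≤b ∷ [-]
  head a b (c ∷ v) a≤b (c≤b ∷ ds) with c ≤ᵇ a in eq
  ... | true  = a≤b ∷ ≤ᵇ⇒≤ c a (subst T (sym eq) tt) ∷ ds
  ... | false = c≤b ∷ head a c v (<⇒≤ (≰⇒> λ c≤a → subst T eq (≤⇒≤ᵇ c≤a))) ds

sends-insertDec : ∀ a (v : Vec ℕ n) → ∃[ u ] Sends (insertDec a v) (a ∷ v) u
sends-insertDec a []      = idₚ , λ _ → refl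
sends-insertDec a (b ∷ v) with b ≤ᵇ a
... | true  = idₚ , λ _ → refl
... | false with sends-insertDec a v
-- The entry `b` heads the sorted word but stands second in `a ∷ b ∷ v`, hence the transposition
-- after the lift.
...   | u , S = lift₀ u ∘ₚ transpose zero (suc zero) , λ
  { zero    → refl
  ; (suc i) → trans (swapped (u ⟨$⟩ʳ i)) (S i) }
  where
  swapped : ∀ p → lookup (a ∷ b ∷ v) (transpose zero (suc zero) ⟨$⟩ʳ suc p) ≡ lookup (a ∷ v) p
  swapped zero    = refl
  swapped (suc p) = refl

sends-sortDec : (v : Vec ℕ n) → ∃[ u ] Sends (sortDec v) v u
sends-sortDec []      = idₚ , λ ()
sends-sortDec (a ∷ v) with sends-insertDec a (sortDec v) | sends-sortDec v
... | u , S | w , R = u ∘ₚ lift₀ w , λ i → trans (lifted (u ⟨$⟩ʳ i)) (S i)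
  where
  lifted : ∀ p → lookup (a ∷ v) (lift₀ w ⟨$⟩ʳ p) ≡ lookup (a ∷ sortDec v) p
  lifted zero    = refl
  lifted (suc p) = R p

-- A witness would need a search over permutations; ⪯ is only used to prove a
-- decidable inequality, for which the double negation is enough.
¬¬-minimal : (γ : Vec ℕ n) → ¬ ¬ (∃[ u ] IsW γ u)
¬¬-minimal γ ∄u = <-rec (λ m → ∀ u → len u ≡ m → ¬ Sends (sortDec γ) γ u)
  (λ { m rec u refl S → ∄u (u , S , λ v R → ≮⇒≥ λ lt → rec lt v refl R) })
  _ (proj₁ (sends-sortDec γ)) refl (proj₂ (sends-sortDec γ))

-- Both words are placements of one decreasing word, and moving up in Bruhat order can only lower
-- the prefix counts.
⪯⇒dominates : (β α : Vec ℕ n) → β ⪯ α → β Dominates α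
⪯⇒dominates β α (same , bruhat) t k = decidable-stable (atLeast t k α ≤? atLeast t k β) λ fail →
  ¬¬-minimal β λ (u , Su , mu) → ¬¬-minimal α λ (w , Sw , mw) → fail (begin
    atLeast t k α             ≡⟨ atLeast-placed t k (sortDec α) α w Sw ⟩
    placed (sortDec α) t k w  ≡⟨ cong (λ lam → placed lam t k w) same ⟨
    placed (sortDec β) t k w  ≤⟨ placed-bruhat (sortDec β) t k (sortDec-decreasing β) (bruhat u w (Su , mu) (Sw , mw)) ⟩
    placed (sortDec β) t k u  ≡⟨ atLeast-placed t k (sortDec β) β u Su ⟨
    atLeast t k β             ∎)
  where open ≤-Reasoning

-- Newton polytopes

dot : Pt n → Pt n → ℚ
dot []      []      = 0ℚ
dot (x ∷ p) (y ∷ q) = x ℚ.* y ℚ.+ dot p q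

dot-⊕ : ∀ (r p q : Pt n) → dot r (p ⊕ q) ≡ dot r p ℚ.+ dot r q
dot-⊕ []      []      []      = refl
dot-⊕ (z ∷ r) (x ∷ p) (y ∷ q) = trans (cong (z ℚ.* (x ℚ.+ y) ℚ.+_) (dot-⊕ r p q))
  (solve 5 (λ x y z a b → z :* (x :+ y) :+ (a :+ b) := (z :* x :+ a) :+ (z :* y :+ b)) refl x y z (dot r p) (dot r q))
  where open ℚ.+-*-Solver

dot-⊛ : ∀ c (r p : Pt n) → dot r (c ⊛ p) ≡ c ℚ.* dot r p
dot-⊛ c []      []      = sym (ℚ.*-zeroʳ c)
dot-⊛ c (z ∷ r) (x ∷ p) = trans (cong (z ℚ.* (c ℚ.* x) ℚ.+_) (dot-⊛ c r p))
  (solve 4 (λ c x z a → z :* (c :* x) :+ c :* a := c :* (z :* x :+ a)) refl c x z (dot r p))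
  where open ℚ.+-*-Solver

dot-zeroPt : ∀ (r : Pt n) → dot r zeroPt ≡ 0ℚ
dot-zeroPt []      = refl
dot-zeroPt (z ∷ r) = cong₂ ℚ._+_ (ℚ.*-zeroʳ z) (dot-zeroPt r)

square-pos : ∀ {x} → x ≢ 0ℚ → 0ℚ ℚ.< x ℚ.* x
square-pos {x} x≢0 with ℚ.<-cmp x 0ℚ
... | tri< x<0 _ _ = ℚ.positive⁻¹ _ {{ℚ.neg*neg⇒pos x {{ℚ.negative x<0}} x {{ℚ.negative x<0}}}}
... | tri≈ _ x≡0 _ = contradiction x≡0 x≢0
... | tri> _ _ x>0 = ℚ.positive⁻¹ _ {{ℚ.pos*pos⇒pos x {{ℚ.positive x>0}} x {{ℚ.positive x>0}}}}

square-nonneg : ∀ x → 0ℚ ℚ.≤ x ℚ.* x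
square-nonneg x with x ℚ.≟ 0ℚ
... | yes refl = ℚ.≤-refl
... | no x≢0   = ℚ.<⇒≤ (square-pos x≢0)

dist² : Pt n → Pt n → ℚ
dist² []      []      = 0ℚ
dist² (x ∷ p) (y ∷ q) = (x ℚ.- y) ℚ.* (x ℚ.- y) ℚ.+ dist² p q

dist²-nonneg : ∀ (p q : Pt n) → 0ℚ ℚ.≤ dist² p q
dist²-nonneg []      []      = ℚ.≤-refl
dist²-nonneg (x ∷ p) (y ∷ q) = ℚ.+-mono-≤ (square-nonneg (x ℚ.- y)) (dist²-nonneg p q)

dist²-≤0 : ∀ (p q : Pt n) → dist² p q ℚ.≤ 0ℚ → p ≡ q
dist²-≤0 []      []      _ = refl
dist²-≤0 (x ∷ p) (y ∷ q) D with x ℚ.- y ℚ.≟ 0ℚ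
... | no x-y≢0  = contradiction (ℚ.<-≤-trans (ℚ.+-mono-<-≤ (square-pos x-y≢0) (dist²-nonneg p q)) D) (ℚ.<-irrefl refl)
... | yes x-y≡0 = cong₂ _∷_
  (begin
    x                    ≡⟨ solve 2 (λ x y → x := (x :- y) :+ y) refl x y ⟩
    x ℚ.- y ℚ.+ y        ≡⟨ cong (ℚ._+ y) x-y≡0 ⟩
    0ℚ ℚ.+ y             ≡⟨ ℚ.+-identityˡ y ⟩
    y                    ∎)
  (dist²-≤0 p q (subst (ℚ._≤ 0ℚ) (trans (cong (λ z → z ℚ.* z ℚ.+ dist² p q) x-y≡0) (ℚ.+-identityˡ _)) D))
  where
  open ≡-Reasoning
  open ℚ.+-*-Solver

dist²-expand : ∀ (p q : Pt n) → dot p q ℚ.+ dot p q ℚ.+ dist² p q ≡ dot p p ℚ.+ dot q q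
dist²-expand []      []      = refl
dist²-expand (x ∷ p) (y ∷ q) = begin
  (x ℚ.* y ℚ.+ d) ℚ.+ (x ℚ.* y ℚ.+ d) ℚ.+ ((x ℚ.- y) ℚ.* (x ℚ.- y) ℚ.+ e)
    ≡⟨ solve 4 (λ x y d e → (x :* y :+ d) :+ (x :* y :+ d) :+ ((x :- y) :* (x :- y) :+ e) := x :* x :+ y :* y :+ (d :+ d :+ e)) refl x y d e ⟩
  x ℚ.* x ℚ.+ y ℚ.* y ℚ.+ (d ℚ.+ d ℚ.+ e)
    ≡⟨ cong (x ℚ.* x ℚ.+ y ℚ.* y ℚ.+_) (dist²-expand p q) ⟩
  x ℚ.* x ℚ.+ y ℚ.* y ℚ.+ (dot p p ℚ.+ dot q q)
    ≡⟨ solve 4 (λ a b c d → a :+ b :+ (c :+ d) := a :+ c :+ (b :+ d)) refl (x ℚ.* x) (y ℚ.* y) (dot p p) (dot q q) ⟩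
  x ℚ.* x ℚ.+ dot p p ℚ.+ (y ℚ.* y ℚ.+ dot q q) ∎
  where
  open ≡-Reasoning
  open ℚ.+-*-Solver
  d = dot p q
  e = dist² p q

-- Serves as Cauchy-Schwarz in a form linear in `dot p q`, which can be summed over a weighted
-- combination.
dot-double-≤ : ∀ (p q : Pt n) → dot p q ℚ.+ dot p q ℚ.≤ dot p p ℚ.+ dot q q
dot-double-≤ p q = begin
  D                     ≡⟨ ℚ.+-identityʳ D ⟨
  D ℚ.+ 0ℚ              ≤⟨ ℚ.+-monoʳ-≤ D (dist²-nonneg p q) ⟩
  D ℚ.+ dist² p q       ≡⟨ dist²-expand p q ⟩
  dot p p ℚ.+ dot q q   ∎
  where
  open ℚ.≤-Reasoning
  D = dot p q ℚ.+ dot p q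

-- The exact defect t(1-t)|p-q|² in the convexity of the squared norm.
strict-convexity : ∀ t (p q : Pt n) → let v = (t ⊛ p) ⊕ ((1ℚ ℚ.- t) ⊛ q) in
  dot v v ℚ.+ t ℚ.* (1ℚ ℚ.- t) ℚ.* dist² p q ≡ t ℚ.* dot p p ℚ.+ (1ℚ ℚ.- t) ℚ.* dot q q
strict-convexity t []      []      = solve 1 (λ t → con 0ℚ :+ t :* (con 1ℚ :- t) :* con 0ℚ := t :* con 0ℚ :+ (con 1ℚ :- t) :* con 0ℚ) refl t
  where open ℚ.+-*-Solver
strict-convexity t (x ∷ p) (y ∷ q) = begin
  z ℚ.* z ℚ.+ V ℚ.+ t ℚ.* s ℚ.* ((x ℚ.- y) ℚ.* (x ℚ.- y) ℚ.+ D)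
    ≡⟨ solve 5 (λ t x y V D → let s = con 1ℚ :- t ; z = t :* x :+ s :* y in
         z :* z :+ V :+ t :* s :* ((x :- y) :* (x :- y) :+ D) := t :* (x :* x) :+ s :* (y :* y) :+ (V :+ t :* s :* D)) refl t x y V D ⟩
  t ℚ.* (x ℚ.* x) ℚ.+ s ℚ.* (y ℚ.* y) ℚ.+ (V ℚ.+ t ℚ.* s ℚ.* D)
    ≡⟨ cong (t ℚ.* (x ℚ.* x) ℚ.+ s ℚ.* (y ℚ.* y) ℚ.+_) (strict-convexity t p q) ⟩
  t ℚ.* (x ℚ.* x) ℚ.+ s ℚ.* (y ℚ.* y) ℚ.+ (t ℚ.* P ℚ.+ s ℚ.* Q)
    ≡⟨ solve 6 (λ t s a b P Q → t :* a :+ s :* b :+ (t :* P :+ s :* Q) := t :* (a :+ P) :+ s :* (b :+ Q)) refl t s (x ℚ.* x) (y ℚ.* y) P Q ⟩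
  t ℚ.* (x ℚ.* x ℚ.+ P) ℚ.+ s ℚ.* (y ℚ.* y ℚ.+ Q) ∎
  where
  open ≡-Reasoning
  open ℚ.+-*-Solver
  s = 1ℚ ℚ.- t
  z = t ℚ.* x ℚ.+ s ℚ.* y
  V = dot ((t ⊛ p) ⊕ (s ⊛ q)) ((t ⊛ p) ⊕ (s ⊛ q))
  D = dist² p q
  P = dot p p
  Q = dot q q

-- Integer norms as rational norms

fromℕ : ℕ → ℚ
fromℕ k = ℤ.+ k ℚ./ 1

fromℕ-mkℚ : ∀ k → fromℕ k ≡ ℚ.mkℚ (ℤ.+ k) 0 (coprime-sym (1-coprimeTo k))
fromℕ-mkℚ k = ℚ.normalize-coprime (coprime-sym (1-coprimeTo k))

fromℕ-+ : ∀ a b → fromℕ (a ℕ.+ b) ≡ fromℕ a ℚ.+ fromℕ b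
fromℕ-+ a b rewrite fromℕ-mkℚ a | fromℕ-mkℚ b =
  cong (ℚ._/ 1) (sym (cong₂ ℤ._+_ (ℤ.*-identityʳ (ℤ.+ a)) (ℤ.*-identityʳ (ℤ.+ b))))

fromℕ-* : ∀ a b → fromℕ (a ℕ.* b) ≡ fromℕ a ℚ.* fromℕ b
fromℕ-* a b rewrite fromℕ-mkℚ a | fromℕ-mkℚ b = cong (ℚ._/ 1) (ℤ.pos-* a b)

fromℕ-mono : ∀ {a b} → a ℕ.≤ b → fromℕ a ℚ.≤ fromℕ b
fromℕ-mono {a} {b} a≤b rewrite fromℕ-mkℚ a | fromℕ-mkℚ b =
  ℚ.*≤* (ℤ.*-monoʳ-≤-nonNeg (ℤ.+ 1) (ℤ.+≤+ a≤b))

dot-toPt : (e : Vec ℕ n) → dot (toPt e) (toPt e) ≡ fromℕ (norm² e)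
dot-toPt []      = refl
dot-toPt (a ∷ e) = sym (trans (fromℕ-+ (a ℕ.* a) (norm² e)) (cong₂ ℚ._+_ (fromℕ-* a a) (sym (dot-toPt e))))

-- The total weight stays on the right, unnormalised, so that induction on the list goes through.
dot-wcomb-≤ : ∀ {f : Poly n} {N} r ws → All (λ w → (0ℚ ℚ.≤ proj₁ w) × InSupp f (proj₂ w)) ws →
              (∀ e → InSupp f e → dot (toPt e) (toPt e) ℚ.≤ N) →
              dot r (wcomb ws) ℚ.+ dot r (wcomb ws) ℚ.≤ wsum ws ℚ.* (dot r r ℚ.+ N)
dot-wcomb-≤ {N = N} r [] [] _ = ℚ.≤-reflexive (trans (cong₂ ℚ._+_ (dot-zeroPt r) (dot-zeroPt r)) (sym (ℚ.*-zeroˡ (dot r r ℚ.+ N))))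
dot-wcomb-≤ {f = f} {N} r ((c , e) ∷ ws) ((c≥0 , e∈f) ∷ all) supp = begin
  dot r ((c ⊛ toPt e) ⊕ wcomb ws) ℚ.+ dot r ((c ⊛ toPt e) ⊕ wcomb ws)
    ≡⟨ cong₂ ℚ._+_ split split ⟩
  (c ℚ.* d ℚ.+ W) ℚ.+ (c ℚ.* d ℚ.+ W)
    ≡⟨ solve 3 (λ c d W → (c :* d :+ W) :+ (c :* d :+ W) := c :* (d :+ d) :+ (W :+ W)) refl c d W ⟩
  c ℚ.* (d ℚ.+ d) ℚ.+ (W ℚ.+ W)
    ≤⟨ ℚ.+-mono-≤
         (ℚ.*-monoˡ-≤-nonNeg c {{ℚ.nonNegative c≥0}} (ℚ.≤-trans (dot-double-≤ r (toPt e)) (ℚ.+-monoʳ-≤ (dot r r) (supp e e∈f))))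
         (dot-wcomb-≤ {f = f} r ws all supp) ⟩
  c ℚ.* (dot r r ℚ.+ N) ℚ.+ wsum ws ℚ.* (dot r r ℚ.+ N)
    ≡⟨ ℚ.*-distribʳ-+ (dot r r ℚ.+ N) c (wsum ws) ⟨
  (c ℚ.+ wsum ws) ℚ.* (dot r r ℚ.+ N) ∎
  where
  open ℚ.≤-Reasoning
  open ℚ.+-*-Solver
  d = dot r (toPt e)
  W = dot r (wcomb ws)
  split : dot r ((c ⊛ toPt e) ⊕ wcomb ws) ≡ c ℚ.* d ℚ.+ W
  split = trans (dot-⊕ r (c ⊛ toPt e) (wcomb ws)) (cong (ℚ._+ W) (dot-⊛ c r (toPt e)))

-- Taking r = p in `dot-wcomb-≤` gives 2|p|² ≤ |p|² + N.
newton-⊆-ball : ∀ {f : Poly n} {N} p → InNewton f p → (∀ e → InSupp f e → dot (toPt e) (toPt e) ℚ.≤ N) → dot p p ℚ.≤ N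
newton-⊆-ball {f = f} {N} p (ws , all , sum≡1 , comb≡p) supp = ℚ.≮⇒≥ λ N<pp → ℚ.<-irrefl refl (ℚ.<-≤-trans (ℚ.+-monoʳ-< (dot p p) N<pp) (begin
  dot p p ℚ.+ dot p p                    ≡⟨ cong (λ q → dot p q ℚ.+ dot p q) comb≡p ⟨
  dot p (wcomb ws) ℚ.+ dot p (wcomb ws)  ≤⟨ dot-wcomb-≤ {f = f} p ws all supp ⟩
  wsum ws ℚ.* (dot p p ℚ.+ N)            ≡⟨ cong (ℚ._* (dot p p ℚ.+ N)) sum≡1 ⟩
  1ℚ ℚ.* (dot p p ℚ.+ N)                 ≡⟨ ℚ.*-identityˡ (dot p p ℚ.+ N) ⟩
  dot p p ℚ.+ N                          ∎))
  where open ℚ.≤-Reasoning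

⊛-identity : ∀ (p : Pt n) → 1ℚ ⊛ p ≡ p
⊛-identity []      = refl
⊛-identity (x ∷ p) = cong₂ _∷_ (ℚ.*-identityˡ x) (⊛-identity p)

⊕-identity : ∀ (p : Pt n) → p ⊕ zeroPt ≡ p
⊕-identity []      = refl
⊕-identity (x ∷ p) = cong₂ _∷_ (ℚ.+-identityʳ x) (⊕-identity p)

support-in-newton : ∀ (f : Poly n) e → InSupp f e → InNewton f (toPt e)
support-in-newton f e e∈f = (1ℚ , e) ∷ [] , (ℚ.nonNegative⁻¹ 1ℚ , e∈f) ∷ [] , refl ,
  trans (⊕-identity (1ℚ ⊛ toPt e)) (⊛-identity (toPt e))

maximal-norm²-vertex : ∀ (f : Poly n) b → InSupp f b → (∀ e → InSupp f e → norm² e ℕ.≤ norm² b) → IsVertex f (toPt b)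
maximal-norm²-vertex {n} f b b∈f max = support-in-newton f b b∈f , extreme
  where
  N = dot (toPt b) (toPt b)
  bound : ∀ e → InSupp f e → dot (toPt e) (toPt e) ℚ.≤ N
  bound e e∈f = subst₂ ℚ._≤_ (sym (dot-toPt e)) (sym (dot-toPt b)) (fromℕ-mono (max e e∈f))
  extreme : ∀ p q t → InNewton f p → InNewton f q → 0ℚ ℚ.< t → t ℚ.< 1ℚ → toPt b ≡ (t ⊛ p) ⊕ ((1ℚ ℚ.- t) ⊛ q) → p ≡ q
  -- A positive distance between p and q would give N < N + t(1-t)|p-q|² = t|p|² + (1-t)|q|² ≤ N.
  extreme p q t p∈ q∈ 0<t t<1 b≡ = dist²-≤0 p q (ℚ.*-cancelˡ-≤-pos (t ℚ.* s) {{ts>0}}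
    (subst (t ℚ.* s ℚ.* dist² p q ℚ.≤_) (sym (ℚ.*-zeroʳ (t ℚ.* s))) (ℚ.≮⇒≥ λ D>0 → ℚ.<-irrefl refl (begin-strict
      N                                      ≡⟨ ℚ.+-identityʳ N ⟨
      N ℚ.+ 0ℚ                               <⟨ ℚ.+-monoʳ-< N D>0 ⟩
      N ℚ.+ t ℚ.* s ℚ.* dist² p q            ≡⟨ cong (λ v → dot v v ℚ.+ t ℚ.* s ℚ.* dist² p q) b≡ ⟩
      _                                      ≡⟨ strict-convexity t p q ⟩
      t ℚ.* dot p p ℚ.+ s ℚ.* dot q q        ≤⟨ ℚ.+-mono-≤ (ℚ.*-monoˡ-≤-nonNeg t {{ℚ.pos⇒nonNeg t {{t>0}}}} (newton-⊆-ball {f = f} p p∈ bound))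
                                                           (ℚ.*-monoˡ-≤-nonNeg s {{ℚ.pos⇒nonNeg s {{s>0}}}} (newton-⊆-ball {f = f} q q∈ bound)) ⟩
      t ℚ.* N ℚ.+ s ℚ.* N                    ≡⟨ solve 2 (λ t N → t :* N :+ (con 1ℚ :- t) :* N := N) refl t N ⟩
      N                                      ∎))))
    where
    open ℚ.≤-Reasoning
    open ℚ.+-*-Solver
    s = 1ℚ ℚ.- t
    t>0 = ℚ.positive 0<t
    s>0 : ℚ.Positive s
    s>0 = ℚ.positive (subst (ℚ._< s) (ℚ.+-inverseʳ t) (ℚ.+-monoˡ-< (ℚ.- t) t<1))
    ts>0 = ℚ.pos*pos⇒pos t {{t>0}} s {{s>0}}

-- Vertices of the Newton polytope of a key polynomial

key-support-norm² : ∀ (α e : Vec ℕ n) → InSupp (key α) e → norm² e ℕ.≤ norm² α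
key-support-norm² {n} α e e∈ = ℕ.≮⇒≥ λ lt → e∈ (coeff-absent (key α) e
  (All.map (λ le eq → ℕ.<⇒≱ lt (subst (λ v → norm² v ℕ.≤ norm² α) eq le)) (key-norm² (n ℕ.* n) α)))

theorem3p12 : (n : ℕ) (α β : Vec ℕ n) → β ⪯ α → IsVertex (key α) (toPt β)
theorem3p12 n α β β⪯α@(same , _) = maximal-norm²-vertex (key α) β
  (λ c≡0 → contradiction (trans (sym c≡0) c≡1) λ ())
  (λ e e∈ → ℕ.≤-trans (key-support-norm² α e e∈) (ℕ.≤-reflexive (sym norm²≡)))
  where
  norm²≡ : norm² β ≡ norm² α
  norm²≡ = trans (sym (norm²-sortDec β)) (trans (cong norm² same) (norm²-sortDec α))
  c≡1 : coeff (key α) β ≡ ℤ.1ℤ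
  c≡1 = key-coeff (n ℕ.* n) α β (ascents-≤ α) (⪯⇒dominates β α β⪯α)
    (λ t → trans (sym (atLeast-sortDec t β)) (trans (cong (atLeast t n) same) (atLeast-sortDec t α))) norm²≡
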